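{- For any $\mathcal L_{\mathsf{pf}}$-formula $A$, the following are equivalent: (1) $\mathbf{PF}\vdash A$; (2) $A$ is valid on all $\mathbf{PF}$-frames; (3) $A$ is valid on all finite rooted nice PBA $\mathbf{PF}$-frames; (4) for every Kripke model $\mathcal M$ based on a finite rooted nice PBA $\mathbf{PF}$-frame, $A$ is true at every $\preccurlyeq$-root element of the $\sqsubset$-root cluster of $\mathcal M$.
   Context: $\mathcal L_{\mathsf{pf}}$ is the bimodal propositional language with modal operators $\Box_{\mathsf p},\Box_{\mathsf f}$ ($\Diamond_{\mathsf p}=\neg\Box_{\mathsf p}\neg$, $\Diamond_{\mathsf f}=\neg\Box_{\mathsf f}\neg$). The logic $\mathbf{PF}$ has axioms: all propositional tautologies; $\Box_{\mathsf p}(A\to B)\to(\Box_{\mathsf p}A\to\Box_{\mathsf p}B)$; $\Box_{\mathsf p}(\Box_{\mathsf p}A\to A)\to\Box_{\mathsf p}A$; $\Box_{\mathsf f}(A\to B)\to(\Box_{\mathsf f}A\to\Box_{\mathsf f}B)$; $\Box_{\mathsf f}A\to A$; $\Box_{\mathsf f}A\to\Box_{\mathsf f}\Box_{\mathsf f}A$; $\Diamond_{\mathsf f}\Box_{\mathsf f}A\to\Box_{\mathsf f}\Diamond_{\mathsf f}A$; $\Box_{\mathsf p}A\to\Box_{\mathsf f}\Box_{\mathsf p}A$; $\Diamond_{\mathsf p}A\to\Box_{\mathsf f}\Diamond_{\mathsf p}A$; $\Box_{\mathsf p}A\to\Box_{\mathsf p}\Box_{\mathsf f}A$; rules: modus ponens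 and necessitation for each of $\Box_{\mathsf p},\Box_{\mathsf f}$. A Kripke frame is $(W,\sqsubset,\preccurlyeq)$ with $W\neq\emptyset$ and binary relations $\sqsubset$ (for $\Box_{\mathsf p}$) and $\preccurlyeq$ (for $\Box_{\mathsf f}$); in a model, $x\Vdash\Box_{\mathsf p}B$ iff $y\Vdash B$ for all $y$ with $x\sqsubset y$, and $x\Vdash\Box_{\mathsf f}B$ iff $y\Vdash B$ for all $y$ with $x\preccurlyeq y$. A formula is valid on a frame if true at every point of every model on it. A $\mathbf{PF}$-frame is a frame on which all theorems of $\mathbf{PF}$ are valid. For a $\mathbf{PF}$-frame, let $\sim$ be the symmetric closure of $\preccurlyeq$ and $\sim^+$ its transitive closure; the $\sim^+$-equivalence classes are called clusters, $\mathcal C_x$ denoting the cluster of $x$. A $\mathbf{PF}$-frame is nice if for all $x,y,z$: $x\sqsubset z$ and $y\preccurlyeq z$ imply $x\sqsubset y$; in a nice frame one writes $\mathcal C_x\sqsubset\mathcal C_y$ iff $x\sqsubset y$ (well defined). A nice $\mathbf{PF}$-frame is rooted if (i) there is $r$ with, for every $x$, either $\mathcal C_r=\mathcal C_x$ or $\mathcal C_r\sqsubset\mathcal C_x$ ($\mathcal C_r$ is the $\sqsubset$-root cluster), and (ii) every cluster $\mathcal C$ has a $\preccurlyeq$-root element, i.e. some $x\in\mathcal C$ with $x\preccurlyeq y$ for all $y\in\mathcal C$. It is PBA if moreover each $(\mathcal C,\preccurlyeq)$ is a pre-Boolean algebra: letting $x\approx y$ iff $x\preccurlyeq y$ and $y\preccurlyeq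 x$, the quotient $(\mathcal C/{\approx},\preccurlyeq)$ is a Boolean algebra. -}

module Defs where

open import Data.Nat using (ℕ)
open import Data.Bool using (Bool; true; false; not; _∨_)
open import Data.Fin using (Fin)
open import Data.Empty using (⊥)
open import Data.Product using (Σ; ∃; _×_; _,_)
open import Data.Sum using (_⊎_)
open import Relation.Binary.PropositionalEquality using (_≡_)
open import Function.Bundles using (_↔_)
open import Relation.Binary.Lattice.Structures using (IsBooleanAlgebra)
open import Algebra.Core using (Op₁; Op₂)
open import Level using (0ℓ) renaming (suc to lsuc)

infixr 6 _⇒_

data Fm : Set where
  var : ℕ → Fm
  ⊥'  : Fm
  _⇒_ : Fm → Fm → Fm
  □p  : Fm → Fm
  □f  : Fm → Fm

¬' : Fm → Fm
¬' A = A ⇒ ⊥'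

◇p : Fm → Fm
◇p A = ¬' (□p (¬' A))

◇f : Fm → Fm
◇f A = ¬' (□f (¬' A))

beval : (Fm → Bool) → Fm → Bool
beval ρ ⊥'      = false
beval ρ (A ⇒ B) = not (beval ρ A) ∨ beval ρ B
beval ρ A       = ρ A

Tautology : Fm → Set
Tautology A = (ρ : Fm → Bool) → beval ρ A ≡ true

data PF⊢_ : Fm → Set where
  taut   : ∀ {A} → Tautology A → PF⊢ A
  Kp     : ∀ A B → PF⊢ (□p (A ⇒ B) ⇒ (□p A ⇒ □p B))
  Löb    : ∀ A → PF⊢ (□p (□p A ⇒ A) ⇒ □p A)
  Kf     : ∀ A B → PF⊢ (□f (A ⇒ B) ⇒ (□f A ⇒ □f B))
  Tf     : ∀ A → PF⊢ (□f A ⇒ A)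
  4f     : ∀ A → PF⊢ (□f A ⇒ □f (□f A))
  G2f    : ∀ A → PF⊢ (◇f (□f A) ⇒ □f (◇f A))
  pf1    : ∀ A → PF⊢ (□p A ⇒ □f (□p A))
  pf2    : ∀ A → PF⊢ (◇p A ⇒ □f (◇p A))
  pf3    : ∀ A → PF⊢ (□p A ⇒ □p (□f A))
  mp     : ∀ {A B} → PF⊢ (A ⇒ B) → PF⊢ A → PF⊢ B
  necp   : ∀ {A} → PF⊢ A → PF⊢ □p A
  necf   : ∀ {A} → PF⊢ A → PF⊢ □f A

record Frame : Set₁ where
  field
    W     : Set
    inhab : W
    _⊏_   : W → W → Set
    _≼_   : W → W → Set

Valuation : Frame → Set
Valuation F = ℕ → Frame.W F → Bool

module _ (F : Frame) where
  open Frame F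

  _,_⊩_ : Valuation F → W → Fm → Set
  V , x ⊩ var n = V n x ≡ true
  V , x ⊩ ⊥'    = ⊥
  V , x ⊩ (A ⇒ B) = V , x ⊩ A → V , x ⊩ B
  V , x ⊩ □p A  = ∀ y → x ⊏ y → V , y ⊩ A
  V , x ⊩ □f A  = ∀ y → x ≼ y → V , y ⊩ A

  ValidOn : Fm → Set
  ValidOn A = (V : Valuation F) (x : W) → V , x ⊩ A

  IsPFFrame : Set
  IsPFFrame = ∀ A → PF⊢ A → ValidOn A

  IsFinite : Set
  IsFinite = Σ ℕ λ n → Fin n ↔ W

  _∼_ : W → W → Set
  x ∼ y = x ≼ y ⊎ y ≼ x

  data _∼⁺_ : W → W → Set where
    [_]  : ∀ {x y} → x ∼ y → x ∼⁺ y
    _∷_  : ∀ {x y z} → x ∼ y → y ∼⁺ z → x ∼⁺ z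

  IsNice : Set
  IsNice = ∀ x y z → x ⊏ z → y ≼ z → x ⊏ y

  -- r is in the ⊏-root cluster: for every x, C_r = C_x or C_r ⊏ C_x
  IsSqRoot : W → Set
  IsSqRoot r = ∀ x → r ∼⁺ x ⊎ r ⊏ x

  Is≼Root : W → Set
  Is≼Root z = ∀ y → z ∼⁺ y → z ≼ y

  -- rooted (for nice PF-frames): (i) a ⊏-root cluster exists,
  -- (ii) every cluster C_x has a ≼-root element
  IsRooted : Set
  IsRooted = (Σ W λ r → IsSqRoot r)
           × (∀ x → Σ W λ z → (x ∼⁺ z) × Is≼Root z)

  Cluster : W → Set
  Cluster x = Σ W λ y → x ∼⁺ y

  module _ (x : W) where
    _≼c_ : Cluster x → Cluster x → Set
    (a , _) ≼c (b , _) = a ≼ b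

    _≈c_ : Cluster x → Cluster x → Set
    a ≈c b = (a ≼c b) × (b ≼c a)

  -- (C_x / ≈, ≼) is a Boolean algebra (order-theoretic notion from
  -- the standard library, on the setoid (C_x, ≈))
  IsPreBooleanCluster : W → Set
  IsPreBooleanCluster x =
    Σ (Op₂ (Cluster x)) λ _∨c_ → Σ (Op₂ (Cluster x)) λ _∧c_ →
    Σ (Op₁ (Cluster x)) λ ¬c → Σ (Cluster x) λ ⊤c → Σ (Cluster x) λ ⊥c →
    IsBooleanAlgebra (_≈c_ x) (_≼c_ x) _∨c_ _∧c_ ¬c ⊤c ⊥c

  IsPBA : Set
  IsPBA = ∀ x → IsPreBooleanCluster x

FinRootedNicePBA : Frame → Set
FinRootedNicePBA F =
  IsFinite F × IsPFFrame F × IsNice F × IsRooted F × IsPBA F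

Cond1 : Fm → Set
Cond1 A = PF⊢ A

Cond2 : Fm → Set₁
Cond2 A = (F : Frame) → IsPFFrame F → ValidOn F A

Cond3 : Fm → Set₁
Cond3 A = (F : Frame) → FinRootedNicePBA F → ValidOn F A

Cond4 : Fm → Set₁
Cond4 A = (F : Frame) → FinRootedNicePBA F →
  (V : Valuation F) (r z : Frame.W F) →
  IsSqRoot F r → _∼⁺_ F r z → Is≼Root F z → _,_⊩_ F V z A

{-# OPTIONS --safe #-}
module Submission where

-- Completeness by elimination: let Φ be the subformulas of A.  A description assigns truth values to
-- Φ and to □p X, □f X and ◇f □f X for X ∈ Φ.  Starting from all descriptions,
-- those violating an instance of Tf or lacking a witness for a false box are
-- discarded one by one, each time because a theorem of PF is false there; so a formula
-- true in all surviving descriptions is provable.  The survivors above a fixed one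
-- form, under ≼, a preorder with bottom and top (by G2f, ◇f □f X is constant
-- along ≼), which is the image of a pre-Boolean algebra.  Putting such algebras
-- on the survivors ⊏-above e₀, and on e₀ itself, gives a model in which A fails if
-- A is false at e₀.  The elimination is effective, so no excluded middle is needed.

open import Defs
open import Function.Bundles using (_⇔_; mk⇔; _↔_; mk↔ₛ′; Inverse)
open import Function.Base using (flip)
open import Function.Properties.Inverse using (↔-refl; ↔-trans)
open import Data.Product.Function.NonDependent.Propositional using (_×-↔_)
open import Level using (0ℓ)
open import Data.Fin using (Fin; zero; suc)
import Data.Fin.Properties as Fin
open import Data.Fin.Induction using (spo-noetherian)
open import Data.Fin.Subset as S using (Subset; _⊆_; _∪_; _∩_; ∁; ⁅_⁆) renaming (_∈_ to _∈ₛ_)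
import Data.Fin.Subset.Properties as S
open import Data.Vec using ([]; _∷_; uncons)
open import Data.Product using (_×_; _,_; proj₁; proj₂; Σ; ∃; uncurry)
open import Data.Sum as Sum using (_⊎_; inj₁; inj₂)
open import Data.Empty using (⊥-elim)
open import Data.Bool using (Bool; true; false; not; _∨_; if_then_else_)
import Data.Bool.Properties as Bool
open import Data.Nat using (ℕ; suc; _<_)
import Data.Nat as ℕ
import Data.Nat.Properties as ℕ
import Data.Nat.Induction as ℕ
open import Data.List using (List; []; _∷_; _++_; map; foldr; filter; length; lookup; allFin)
import Data.List.Properties as List
open import Data.List.Relation.Unary.All as All using (All; []; _∷_)
import Data.List.Relation.Unary.All.Properties as All
open import Data.List.Relation.Unary.Any as Any using (Any; here; there)
import Data.List.Relation.Unary.Any.Properties as Any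
open import Data.List.Membership.Propositional using (_∈_; find; lose)
open import Data.List.Membership.Propositional.Properties
  using (∈-++⁺ˡ; ∈-++⁺ʳ; ∈-++⁻; ∈-map⁺; ∈-filter⁺; ∈-filter⁻; ∈-lookup; ∈-allFin)
open import Induction.WellFounded using (Acc; acc; WellFounded)
open import Relation.Binary.Core using (Rel)
open import Relation.Binary.Structures using (IsStrictPartialOrder)
open import Relation.Binary.Definitions using (Decidable; DecidableEquality)
open import Relation.Binary.PropositionalEquality
  using (_≡_; refl; sym; trans; cong; cong₂; subst; resp₂; isEquivalence)
open import Relation.Nullary using (¬_; Dec; yes; no; does)
open import Relation.Nullary.Decidable using (map′; ¬?; _×-dec_; _→-dec_; _⊎-dec_; decidable-stable)

-- Derivations in PF

-- A record rather than the bare equation, so that `ρ` and `A` can be inferred although `beval`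
-- computes.
record _⊨_ (ρ : Fm → Bool) (A : Fm) : Set where
  constructor holds
  field value : beval ρ A ≡ true
open _⊨_

infix 4 _⊨_

_⊨?_ : Decidable _⊨_
ρ ⊨? A = map′ holds value (beval ρ A Bool.≟ true)

module _ {ρ : Fm → Bool} where

  ⊨-stable : ∀ {A} → ¬ ¬ (ρ ⊨ A) → ρ ⊨ A
  ⊨-stable {A} = decidable-stable (ρ ⊨? A)

  ⊨-⇒⁺ : ∀ {A B} → (ρ ⊨ A → ρ ⊨ B) → ρ ⊨ A ⇒ B
  ⊨-⇒⁺ {A} {B} f with beval ρ A in eq
  ... | true  = holds (trans (cong (λ b → not b ∨ beval ρ B) eq) (value (f (holds eq))))
  ... | false = holds (cong (λ b → not b ∨ beval ρ B) eq)

  ⊨-⇒⁻ : ∀ {A B} → ρ ⊨ A ⇒ B → ρ ⊨ A → ρ ⊨ B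
  ⊨-⇒⁻ {A} {B} (holds h) (holds a) =
    holds (trans (cong (λ b → not b ∨ beval ρ B) (sym a)) h)

  ⊭⊥ : ¬ (ρ ⊨ ⊥')
  ⊭⊥ (holds ())

  ⊨-¬⁺ : ∀ {A} → ¬ (ρ ⊨ A) → ρ ⊨ ¬' A
  ⊨-¬⁺ n = ⊨-⇒⁺ λ a → ⊥-elim (n a)

  ⊨-¬⁻ : ∀ {A} → ρ ⊨ ¬' A → ¬ (ρ ⊨ A)
  ⊨-¬⁻ n a = ⊭⊥ (⊨-⇒⁻ n a)

  ⊨-¬¬⁻ : ∀ {A} → ¬ (ρ ⊨ ¬' A) → ρ ⊨ A
  ⊨-¬¬⁻ n = ⊨-stable λ a → n (⊨-¬⁺ a)


-- Propositional steps are carried out at an arbitrary assignment; this and the next two rules turn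
-- them into derivations.
valid : ∀ {A} → (∀ {ρ} → ρ ⊨ A) → PF⊢ A
valid f = taut λ ρ → value (f {ρ})

by₁ : ∀ {A B} → (∀ {ρ} → ρ ⊨ A → ρ ⊨ B) → PF⊢ A → PF⊢ B
by₁ f a = mp (valid (⊨-⇒⁺ f)) a

by₂ : ∀ {A B C} → (∀ {ρ} → ρ ⊨ A → ρ ⊨ B → ρ ⊨ C) → PF⊢ A → PF⊢ B → PF⊢ C
by₂ f a = mp (by₁ (λ x → ⊨-⇒⁺ (f x)) a)

⇒-trans : ∀ {A B C} → PF⊢ (A ⇒ B) → PF⊢ (B ⇒ C) → PF⊢ (A ⇒ C)
⇒-trans = by₂ λ f g → ⊨-⇒⁺ λ a → ⊨-⇒⁻ g (⊨-⇒⁻ f a)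

contrapose : ∀ {A B} → PF⊢ (A ⇒ B) → PF⊢ (¬' B ⇒ ¬' A)
contrapose = by₁ λ f → ⊨-⇒⁺ λ nb → ⊨-⇒⁺ λ a → ⊨-⇒⁻ nb (⊨-⇒⁻ f a)

infixr 5 _⇛_

_⇛_ : List Fm → Fm → Fm
Γ ⇛ B = foldr _⇒_ B Γ

⊨-⇛⁺ : ∀ {ρ B} Γ → (All (ρ ⊨_) Γ → ρ ⊨ B) → ρ ⊨ Γ ⇛ B
⊨-⇛⁺ []      f = f []
⊨-⇛⁺ (A ∷ Γ) f = ⊨-⇒⁺ λ a → ⊨-⇛⁺ Γ λ as → f (a ∷ as)

⊨-⇛⁻ : ∀ {ρ B} Γ → ρ ⊨ Γ ⇛ B → All (ρ ⊨_) Γ → ρ ⊨ B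
⊨-⇛⁻ []      h []       = h
⊨-⇛⁻ (A ∷ Γ) h (a ∷ as) = ⊨-⇛⁻ Γ (⊨-⇒⁻ h a) as

module Normal (□ : Fm → Fm)
              (K : ∀ A B → PF⊢ (□ (A ⇒ B) ⇒ (□ A ⇒ □ B)))
              (nec : ∀ {A} → PF⊢ A → PF⊢ □ A) where

  □-mono : ∀ {A B} → PF⊢ (A ⇒ B) → PF⊢ (□ A ⇒ □ B)
  □-mono {A} {B} f = mp (K A B) (nec f)

  -- Each pair separates a hypothesis from what it provides under the box, since `□p Y` provides
  -- both `□p Y` and `□f Y` there.
  □-⇛ : ∀ {B} (l : List (Fm × Fm)) → All (λ (α , γ) → PF⊢ (α ⇒ □ γ)) l →
        PF⊢ (□ (map proj₂ l ⇛ B) ⇒ (map proj₁ l ⇛ □ B))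
  □-⇛ []            []       = valid (⊨-⇒⁺ λ b → b)
  □-⇛ ((α , γ) ∷ l) (p ∷ ps) =
    by₂ (λ p' h → ⊨-⇒⁺ λ b → ⊨-⇒⁺ λ a → ⊨-⇒⁻ h (⊨-⇒⁻ (⊨-⇒⁻ p' b) a))
      (by₂ (λ p' k → ⊨-⇒⁺ λ b → ⊨-⇒⁺ λ a → ⊨-⇒⁻ (⊨-⇒⁻ k b) (⊨-⇒⁻ p' a)) p (K γ _))
      (□-⇛ l ps)

  □-⇛-rule : ∀ {B} (l : List (Fm × Fm)) → All (λ (α , γ) → PF⊢ (α ⇒ □ γ)) l →
             PF⊢ (map proj₂ l ⇛ B) → PF⊢ (map proj₁ l ⇛ □ B)
  □-⇛-rule l ps h = mp (□-⇛ l ps) (nec h)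

open Normal □p Kp necp using () renaming (□-mono to □p-mono; □-⇛-rule to □p-⇛)
open Normal □f Kf necf using () renaming (□-mono to □f-mono; □-⇛-rule to □f-⇛)

-- Transitivity of □p follows from Löb's axiom applied to X ∧ □p X.
4p : ∀ X → PF⊢ (□p X ⇒ □p (□p X))
4p X = ⇒-trans (□p-mono (by₁ (λ h → ⊨-⇒⁺ λ x → ⊨-⇒⁺ λ y →
           ⊨-¬⁺ λ n → ⊨-¬⁻ (⊨-⇒⁻ n x) (⊨-⇒⁻ h y)) (□p-mono Y⇒X)))
         (⇒-trans (Löb Y) (□p-mono Y⇒□X))
  where
  Y : Fm
  Y = ¬' (X ⇒ ¬' (□p X))
  Y⇒X : PF⊢ (Y ⇒ X)
  Y⇒X = valid (⊨-⇒⁺ λ y → ⊨-stable λ n → ⊨-¬⁻ y (⊨-⇒⁺ λ x → ⊥-elim (n x)))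
  Y⇒□X : PF⊢ (Y ⇒ □p X)
  Y⇒□X = valid (⊨-⇒⁺ λ y → ⊨-stable λ n → ⊨-¬⁻ y (⊨-⇒⁺ λ _ → ⊨-¬⁺ n))

-- `pf2` at `¬' X` concerns `□p` of a double negation, which is exchanged with `□p X` before and
-- after.
¬□p-persistent : ∀ X → PF⊢ (¬' (□p X) ⇒ □f (¬' (□p X)))
¬□p-persistent X =
  ⇒-trans (contrapose (□p-mono ¬¬X⇒X))
    (⇒-trans (pf2 (¬' X)) (□f-mono (contrapose (□p-mono X⇒¬¬X))))
  where
  ¬¬X⇒X : PF⊢ (¬' (¬' X) ⇒ X)
  ¬¬X⇒X = valid (⊨-⇒⁺ λ h → ⊨-¬¬⁻ (⊨-¬⁻ h))
  X⇒¬¬X : PF⊢ (X ⇒ ¬' (¬' X))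
  X⇒¬¬X = valid (⊨-⇒⁺ λ x → ⊨-¬⁺ λ n → ⊨-¬⁻ n x)

-- `4f` turns `◇f (□f X)` into `◇f (□f (□f X))`, to which `G2f` applies.
◇□f-persistent : ∀ X → PF⊢ (◇f (□f X) ⇒ □f (◇f (□f X)))
◇□f-persistent X = ⇒-trans (contrapose (□f-mono (contrapose (4f X)))) (G2f (□f X))

-- Descriptions and their elimination

_≟_ : DecidableEquality Fm
var m ≟ var n = map′ (cong var) (λ { refl → refl }) (m ℕ.≟ n)
⊥' ≟ ⊥' = yes refl
(A ⇒ B) ≟ (C ⇒ D) =
  map′ (λ (p , q) → cong₂ _⇒_ p q) (λ { refl → refl , refl }) ((A ≟ C) ×-dec (B ≟ D))
□p A ≟ □p B = map′ (cong □p) (λ { refl → refl }) (A ≟ B)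
□f A ≟ □f B = map′ (cong □f) (λ { refl → refl }) (A ≟ B)
var _ ≟ ⊥' = no λ ()
var _ ≟ (_ ⇒ _) = no λ ()
var _ ≟ □p _ = no λ ()
var _ ≟ □f _ = no λ ()
⊥' ≟ var _ = no λ ()
⊥' ≟ (_ ⇒ _) = no λ ()
⊥' ≟ □p _ = no λ ()
⊥' ≟ □f _ = no λ ()
(_ ⇒ _) ≟ var _ = no λ ()
(_ ⇒ _) ≟ ⊥' = no λ ()
(_ ⇒ _) ≟ □p _ = no λ ()
(_ ⇒ _) ≟ □f _ = no λ ()
□p _ ≟ var _ = no λ ()
□p _ ≟ ⊥' = no λ ()
□p _ ≟ (_ ⇒ _) = no λ ()
□p _ ≟ □f _ = no λ ()
□f _ ≟ var _ = no λ ()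
□f _ ≟ ⊥' = no λ ()
□f _ ≟ (_ ⇒ _) = no λ ()
□f _ ≟ □p _ = no λ ()

Desc : Set
Desc = List Bool

assign : List Fm → Desc → Fm → Bool
assign (C ∷ Ψ) (b ∷ d) X = if does (C ≟ X) then b else assign Ψ d X
-- Default outside the list; formulas shown to be `Determined` never read it.
assign _       _       X = false

assign-beval : ∀ {ρ X} Ψ → X ∈ Ψ → assign Ψ (map (beval ρ) Ψ) X ≡ beval ρ X
assign-beval {X = X} (C ∷ Ψ) m with C ≟ X
assign-beval (C ∷ Ψ) m         | yes refl = refl
assign-beval (C ∷ Ψ) (here p)  | no n     = ⊥-elim (n (sym p))
assign-beval (C ∷ Ψ) (there m) | no n     = assign-beval Ψ m

descs : List Fm → List Desc
descs []      = [] ∷ []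
descs (C ∷ Ψ) = map (true ∷_) (descs Ψ) ++ map (false ∷_) (descs Ψ)

∈-descs : ∀ ρ Ψ → map (beval ρ) Ψ ∈ descs Ψ
∈-descs ρ []      = here refl
∈-descs ρ (C ∷ Ψ) with beval ρ C
... | true  = ∈-++⁺ˡ (∈-map⁺ _ (∈-descs ρ Ψ))
... | false = ∈-++⁺ʳ (map (true ∷_) (descs Ψ)) (∈-map⁺ _ (∈-descs ρ Ψ))

all-or : ∀ {A Q : Set} {P : A → Set} (xs : List A) →
         (∀ x → x ∈ xs → P x ⊎ Q) → All P xs ⊎ Q
all-or []       f = inj₁ []
all-or (x ∷ xs) f with f x (here refl) | all-or xs (λ y m → f y (there m))
... | inj₁ p | inj₁ ps = inj₁ (p ∷ ps)
... | inj₂ q | _       = inj₂ q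
... | inj₁ _ | inj₂ q  = inj₂ q

-- Subformula-closed lists

record SubformulaClosed (Φ : List Fm) : Set where
  field
    ⇒ˡ : ∀ {A B} → (A ⇒ B) ∈ Φ → A ∈ Φ
    ⇒ʳ : ∀ {A B} → (A ⇒ B) ∈ Φ → B ∈ Φ
    p  : ∀ {A} → □p A ∈ Φ → A ∈ Φ
    f  : ∀ {A} → □f A ∈ Φ → A ∈ Φ

subs : Fm → List Fm
subs A@(var _) = A ∷ []
subs A@⊥'      = A ∷ []
subs A@(B ⇒ C) = A ∷ subs B ++ subs C
subs A@(□p B)  = A ∷ subs B
subs A@(□f B)  = A ∷ subs B

self∈subs : ∀ A → A ∈ subs A
self∈subs (var _) = here refl
self∈subs ⊥'      = here refl
self∈subs (_ ⇒ _) = here refl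
self∈subs (□p _)  = here refl
self∈subs (□f _)  = here refl

subs-trans : ∀ {B C} A → B ∈ subs A → C ∈ subs B → C ∈ subs A
subs-trans (var _) (here refl) n = n
subs-trans ⊥'      (here refl) n = n
subs-trans (_ ⇒ _) (here refl) n = n
subs-trans (A ⇒ B) (there m)   n with ∈-++⁻ (subs A) m
... | inj₁ l = there (∈-++⁺ˡ (subs-trans A l n))
... | inj₂ r = there (∈-++⁺ʳ (subs A) (subs-trans B r n))
subs-trans (□p _)  (here refl) n = n
subs-trans (□p A)  (there m)   n = there (subs-trans A m n)
subs-trans (□f _)  (here refl) n = n
subs-trans (□f A)  (there m)   n = there (subs-trans A m n)

subs-closed : ∀ A → SubformulaClosed (subs A)
subs-closed A = record
  { ⇒ˡ = λ m → subs-trans A m (there (∈-++⁺ˡ (self∈subs _)))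
  ; ⇒ʳ = λ {B} m → subs-trans A m (there (∈-++⁺ʳ (subs B) (self∈subs _)))
  ; p  = λ m → subs-trans A m (there (self∈subs _))
  ; f  = λ m → subs-trans A m (there (self∈subs _))
  }

module Elimination (Φ : List Fm) (closed : SubformulaClosed Φ) where
  open SubformulaClosed closed

  □f¬□f : Fm → Fm
  □f¬□f X = □f (¬' (□f X))

  -- `◇f (□f X)` is the negation of `□f¬□f X`, so storing the latter fixes both.
  Ψ : List Fm
  Ψ = Φ ++ map □p Φ ++ map □f Φ ++ map □f¬□f Φ

  ⟦_⟧ : Desc → Fm → Bool
  ⟦_⟧ = assign Ψ

  desc : (Fm → Bool) → Desc
  desc ρ = map (beval ρ) Ψ

  Determined : Fm → Set
  Determined X = ∀ ρ → beval ⟦ desc ρ ⟧ X ≡ beval ρ X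

  det⁺ : ∀ {X ρ} → Determined X → ρ ⊨ X → ⟦ desc ρ ⟧ ⊨ X
  det⁺ D (holds h) = holds (trans (D _) h)

  det⁻ : ∀ {X ρ} → Determined X → ⟦ desc ρ ⟧ ⊨ X → ρ ⊨ X
  det⁻ D (holds h) = holds (trans (sym (D _)) h)

  det-¬ : ∀ X → Determined X → Determined (¬' X)
  det-¬ X D ρ = cong (λ b → not b ∨ false) (D ρ)

  det-□p : ∀ {X} → X ∈ Φ → Determined (□p X)
  det-□p m ρ = assign-beval Ψ (∈-++⁺ʳ Φ (∈-++⁺ˡ (∈-map⁺ □p m)))

  det-□f : ∀ {X} → X ∈ Φ → Determined (□f X)
  det-□f m ρ = assign-beval Ψ (∈-++⁺ʳ Φ (∈-++⁺ʳ (map □p Φ) (∈-++⁺ˡ (∈-map⁺ □f m))))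

  det-□f¬□f : ∀ {X} → X ∈ Φ → Determined (□f¬□f X)
  det-□f¬□f m ρ = assign-beval Ψ
    (∈-++⁺ʳ Φ (∈-++⁺ʳ (map □p Φ) (∈-++⁺ʳ (map □f Φ) (∈-map⁺ □f¬□f m))))

  det : ∀ X → X ∈ Φ → Determined X
  det (var n) m ρ = assign-beval Ψ (∈-++⁺ˡ m)
  det ⊥'      m ρ = refl
  det (A ⇒ B) m ρ = cong₂ (λ a b → not a ∨ b) (det A (⇒ˡ m) ρ) (det B (⇒ʳ m) ρ)
  det (□p A)  m   = det-□p (p m)
  det (□f A)  m   = det-□f (f m)

  -- Formulas whose truth is inherited along ≼.  The formulas ◇f □f X are
  -- constant on clusters and say which □f X hold in the final part.
  persistent : List Fm
  persistent = map □p Φ ++ map (λ X → ¬' (□p X)) Φ ++ map □f Φ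
             ++ map □f¬□f Φ ++ map (λ X → ◇f (□f X)) Φ

  all-persistent : ∀ {P : Fm → Set} →
    (∀ {X} → X ∈ Φ → P (□p X)) → (∀ {X} → X ∈ Φ → P (¬' (□p X))) →
    (∀ {X} → X ∈ Φ → P (□f X)) → (∀ {X} → X ∈ Φ → P (□f¬□f X)) →
    (∀ {X} → X ∈ Φ → P (◇f (□f X))) → All P persistent
  all-persistent a b c d e =
    All.++⁺ (go a) (All.++⁺ (go b) (All.++⁺ (go c) (All.++⁺ (go d) (go e))))
    where
    go : ∀ {P : Fm → Set} {g} → (∀ {X} → X ∈ Φ → P (g X)) → All P (map g Φ)
    go h = All.map⁺ (All.tabulate h)

  persistent-det : All Determined persistent
  persistent-det = all-persistent det-□p (λ m → det-¬ (□p _) (det-□p m)) det-□f det-□f¬□f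
                     (λ m → det-¬ (□f¬□f _) (det-□f¬□f m))

  persistent-⊢ : All (λ χ → PF⊢ (χ ⇒ □f χ)) persistent
  persistent-⊢ = all-persistent (λ _ → pf1 _) (λ _ → ¬□p-persistent _) (λ _ → 4f _)
                   (λ _ → 4f _) (λ _ → ◇□f-persistent _)

  infix 4 _≼_ _⊏_

  _≼_ : Desc → Desc → Set
  d ≼ e = All (λ χ → ⟦ d ⟧ ⊨ χ → ⟦ e ⟧ ⊨ χ) persistent

  -- The second clause forces irreflexivity. Witnesses obtained through Löb's axiom meet it with the
  -- very formula whose box is false at `d`.
  _⊏_ : Desc → Desc → Set
  d ⊏ e = All (λ X → ⟦ d ⟧ ⊨ □p X → ⟦ e ⟧ ⊨ □p X × ⟦ e ⟧ ⊨ □f X) Φ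
        × Any (λ X → ⟦ e ⟧ ⊨ □p X × ¬ ⟦ d ⟧ ⊨ □p X) Φ

  _≼?_ : Decidable _≼_
  d ≼? e = All.all? (λ χ → (⟦ d ⟧ ⊨? χ) →-dec (⟦ e ⟧ ⊨? χ)) persistent

  _⊏?_ : Decidable _⊏_
  d ⊏? e =
    All.all? (λ X → (⟦ d ⟧ ⊨? □p X) →-dec ((⟦ e ⟧ ⊨? □p X) ×-dec (⟦ e ⟧ ⊨? □f X))) Φ
    ×-dec Any.any? (λ X → (⟦ e ⟧ ⊨? □p X) ×-dec ¬? (⟦ d ⟧ ⊨? □p X)) Φ

  ≼-refl : ∀ {d} → d ≼ d
  ≼-refl = All.tabulate λ _ h → h

  ≼-trans : ∀ {d e g} → d ≼ e → e ≼ g → d ≼ g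
  ≼-trans r s = All.zipWith (λ (h , k) x → k (h x)) (r , s)

  ⊏-irrefl : ∀ {d} → ¬ d ⊏ d
  ⊏-irrefl (_ , w) with find w
  ... | _ , _ , h , n = n h

  ⊏-trans : ∀ {d e g} → d ⊏ e → e ⊏ g → d ⊏ g
  ⊏-trans (a , _) (b , w) with find w
  ... | X , m , h , n =
    All.zipWith (λ (k , l) x → l (proj₁ (k x))) (a , b) ,
    lose m (h , λ x → n (proj₁ (All.lookup a m x)))

  -- The negations are included so that, where `◇f (□f X)` holds, the witness for the false
  -- `□f¬□f X` is a later description with `□f X`.
  f-boxed : List Fm
  f-boxed = Φ ++ map (λ X → ¬' (□f X)) Φ

  all-f-boxed : ∀ {P : Fm → Set} → (∀ {X} → X ∈ Φ → P X) →
                (∀ {X} → X ∈ Φ → P (¬' (□f X))) → All P f-boxed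
  all-f-boxed a b = All.++⁺ (All.tabulate a) (All.map⁺ (All.tabulate b))

  Witness : List Desc → (Desc → Set) → Fm → Set
  Witness L R X = Any (λ e → R e × ¬ ⟦ e ⟧ ⊨ X) L

  record Saturated (L : List Desc) (d : Desc) : Set where
    field
      reflexive : All (λ X → ⟦ d ⟧ ⊨ □f X → ⟦ d ⟧ ⊨ X) f-boxed
      f-witness : All (λ X → ⟦ d ⟧ ⊨ □f X ⊎ Witness L (d ≼_) X) f-boxed
      p-witness : All (λ X → ⟦ d ⟧ ⊨ □p X ⊎ Witness L (d ⊏_) X) Φ

  -- The invariant of the elimination: a constructive form of "every assignment satisfying the
  -- theorems of PF has its description in `L`".
  Complete : List Desc → Set
  Complete L = ∀ {B} → (∀ {ρ} → desc ρ ∈ L → ρ ⊨ B) → PF⊢ B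

  record Refuted (d : Desc) : Set where
    field
      formula  : Fm
      provable : PF⊢ formula
      false-at : ∀ {ρ} → desc ρ ≡ d → ¬ ρ ⊨ formula

  complete-descs : Complete (descs Ψ)
  complete-descs f = valid λ {ρ} → f (∈-descs ρ Ψ)

  _≟d_ : DecidableEquality Desc
  _≟d_ = List.≡-dec Bool._≟_

  remove : Desc → List Desc → List Desc
  remove d = filter λ e → ¬? (e ≟d d)

  -- At the discarded description `formula` is false, so `formula ⇒ B` holds throughout `L`, and
  -- `formula` is a theorem.
  remove-complete : ∀ {L d} → Complete L → Refuted d → Complete (remove d L)
  remove-complete {L} {d} c r {B} h = mp (c C⇒B) provable
    where
    open Refuted r
    C⇒B : ∀ {ρ} → desc ρ ∈ L → ρ ⊨ formula ⇒ B
    C⇒B {ρ} m = ⊨-⇒⁺ λ x → h (∈-filter⁺ _ m λ eq → false-at eq x)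

  remove-< : ∀ {L d} → d ∈ L → length (remove d L) < length L
  remove-< m = List.filter-notAll _ _ (Any.map (λ eq n → n (sym eq)) m)

  det-f-boxed : All (λ X → Determined X × Determined (□f X)) f-boxed
  det-f-boxed = all-f-boxed (λ m → det _ m , det-□f m)
                            (λ m → det-¬ (□f _) (det-□f m) , det-□f¬□f m)

  transfer⁻ : ∀ {ρ d X} → desc ρ ≡ d → Determined X → ⟦ d ⟧ ⊨ X → ρ ⊨ X
  transfer⁻ refl D = det⁻ D

  transfer⁺ : ∀ {ρ d X} → desc ρ ≡ d → Determined X → ρ ⊨ X → ⟦ d ⟧ ⊨ X
  transfer⁺ refl D = det⁺ D

  module _ {L : List Desc} (complete : Complete L) (d : Desc) where

    reflexive? : ∀ X → X ∈ f-boxed → (⟦ d ⟧ ⊨ □f X → ⟦ d ⟧ ⊨ X) ⊎ Refuted d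
    reflexive? X m with ⟦ d ⟧ ⊨? □f X | ⟦ d ⟧ ⊨? X
    ... | no n  | _     = inj₁ λ h → ⊥-elim (n h)
    ... | yes _ | yes h = inj₁ λ _ → h
    ... | yes h | no n  = inj₂ record
      { formula  = □f X ⇒ X
      ; provable = Tf X
      ; false-at = λ eq k → n (transfer⁺ eq (proj₁ D) (⊨-⇒⁻ k (transfer⁻ eq (proj₂ D) h)))
      }
      where D = All.lookup det-f-boxed m

    -- Without a witness, every assignment described in `L` that satisfies the persistent formulas
    -- `Γ` of `d` satisfies `X`. So `Γ ⇛ X` is derivable; boxing it yields `Γ ⇛ □f X`, which fails
    -- at `d`.
    f-witness? : ∀ X → X ∈ f-boxed → (⟦ d ⟧ ⊨ □f X ⊎ Witness L (d ≼_) X) ⊎ Refuted d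
    f-witness? X m with ⟦ d ⟧ ⊨? □f X
                      | Any.any? (λ e → (d ≼? e) ×-dec ¬? (⟦ e ⟧ ⊨? X)) L
    ... | yes h | _     = inj₁ (inj₁ h)
    ... | no _  | yes w = inj₁ (inj₂ w)
    ... | no n  | no nw = inj₂ record
      { formula  = Γ ⇛ □f X
      ; provable = subst (λ Δ → PF⊢ (Δ ⇛ □f X)) (proj-diag proj₁ (λ _ → refl))
          (□f-⇛ (map (λ χ → χ , χ) Γ)
            (All.map⁺ (All.filter⁺ _ persistent-⊢))
            (subst (λ Δ → PF⊢ (Δ ⇛ X)) (sym (proj-diag proj₂ (λ _ → refl)))
              (complete λ m → ⊨-⇛⁺ Γ (Γ⊨X m))))
      ; false-at = λ eq h → n (transfer⁺ eq (proj₂ D) (⊨-⇛⁻ Γ h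
          (All.zipWith (λ (D , k) → transfer⁻ eq D k)
            (All.filter⁺ true? persistent-det , All.all-filter true? persistent))))
      }
      where
      D = All.lookup det-f-boxed m
      true? : ∀ χ → Dec (⟦ d ⟧ ⊨ χ)
      true? χ = ⟦ d ⟧ ⊨? χ
      Γ = filter true? persistent
      proj-diag : (π : Fm × Fm → Fm) → (∀ χ → π (χ , χ) ≡ χ) →
                  map π (map (λ χ → χ , χ) Γ) ≡ Γ
      proj-diag π e = trans (sym (List.map-∘ Γ)) (trans (List.map-cong e Γ) (List.map-id Γ))
      Γ⊨X : ∀ {ρ} → desc ρ ∈ L → All (ρ ⊨_) Γ → ρ ⊨ X
      Γ⊨X {ρ} i hs = ⊨-stable λ nX → nw (lose i
        ( All.tabulate (λ {χ} j h → det⁺ (All.lookup persistent-det j)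
                                      (All.lookup hs (∈-filter⁺ true? j h)))
        , λ h → nX (det⁻ (proj₁ D) h)))

    -- A description in `L` satisfying the right components of `l` and `□p X` but not `X` would be a
    -- witness, with `□p X` giving strictness. Without one, these components derive `□p X ⇒ X`;
    -- boxing and Löb's axiom give a theorem false at `d`.
    p-witness? : ∀ X → X ∈ Φ → (⟦ d ⟧ ⊨ □p X ⊎ Witness L (d ⊏_) X) ⊎ Refuted d
    p-witness? X m with ⟦ d ⟧ ⊨? □p X
                      | Any.any? (λ e → (d ⊏? e) ×-dec ¬? (⟦ e ⟧ ⊨? X)) L
    ... | yes h | _     = inj₁ (inj₁ h)
    ... | no _  | yes w = inj₁ (inj₂ w)
    ... | no n  | no nw = inj₂ record
      { formula  = map proj₁ l ⇛ □p X
      ; provable = by₂ (λ löb h → ⊨-⇛⁺ (map proj₁ l) λ hs →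
                          ⊨-⇒⁻ löb (⊨-⇛⁻ (map proj₁ l) h hs))
          (Löb X)
          (□p-⇛ l (All.++⁺ (All.map⁺ (All.universal 4p Γ))
                           (All.map⁺ (All.universal pf3 Γ)))
            (complete λ m → ⊨-⇛⁺ (map proj₂ l) (l⊨X m)))
      ; false-at = λ eq h → n (transfer⁺ eq (det-□p m) (⊨-⇛⁻ (map proj₁ l) h
          (All.map⁺ (All.++⁺ (All.map⁺ (true-at eq)) (All.map⁺ (true-at eq))))))
      }
      where
      true? : ∀ Y → Dec (⟦ d ⟧ ⊨ □p Y)
      true? Y = ⟦ d ⟧ ⊨? □p Y
      Γ = filter true? Φ
      l = map (λ Y → □p Y , □p Y) Γ ++ map (λ Y → □p Y , □f Y) Γ
      true-at : ∀ {ρ} → desc ρ ≡ d → All (λ Y → ρ ⊨ □p Y) Γ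
      true-at eq = All.zipWith (λ (D , k) → transfer⁻ eq D k)
        (All.filter⁺ true? (All.tabulate det-□p) , All.all-filter true? Φ)
      l⊨X : ∀ {ρ} → desc ρ ∈ L → All (ρ ⊨_) (map proj₂ l) → ρ ⊨ □p X ⇒ X
      l⊨X {ρ} i hs = ⊨-⇒⁺ λ hX → ⊨-stable λ nX → nw (lose i
        ( ( All.tabulate (λ {Y} j h → let k = ∈-filter⁺ true? j h in
              det⁺ (det-□p j) (All.lookup hs' (∈-++⁺ˡ (∈-map⁺ _ k))) ,
              det⁺ (det-□f j) (All.lookup hs' (∈-++⁺ʳ _ (∈-map⁺ _ k))))
          , lose m (det⁺ (det-□p m) hX , n))
        , λ h → nX (det⁻ (det _ m) h)))
        where
        hs' : All (λ (_ , γ) → ρ ⊨ γ) l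
        hs' = All.map⁻ hs

    saturated? : Saturated L d ⊎ Refuted d
    saturated? with all-or f-boxed reflexive? | all-or f-boxed f-witness? | all-or Φ p-witness?
    ... | inj₁ a | inj₁ b | inj₁ c = inj₁ record
      { reflexive = a ; f-witness = b ; p-witness = c }
    ... | inj₂ r | _      | _      = inj₂ r
    ... | inj₁ _ | inj₂ r | _      = inj₂ r
    ... | inj₁ _ | inj₁ _ | inj₂ r = inj₂ r

  -- A removal may destroy witnesses of other descriptions, so all are checked again; the length of
  -- the list decreases.
  saturate : ∃ λ L → Complete L × All (Saturated L) L
  saturate = go (descs Ψ) complete-descs (ℕ.<-wellFounded _)
    where
    go : ∀ L → Complete L → Acc _<_ (length L) → ∃ λ L → Complete L × All (Saturated L) L
    go L c (acc rec) with all-or {Q = ∃ λ d → d ∈ L × Refuted d} L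
                            (λ d m → Sum.map₂ (λ r → d , m , r) (saturated? c d))
    ... | inj₁ s           = L , c , s
    ... | inj₂ (d , m , r) = go (remove d L) (remove-complete c r) (rec (remove-< m))

-- Frames

-- The frame conditions corresponding to the axioms; finiteness and decidability
-- make forcing decidable, as soundness of the classical tautologies requires.
record PFConditions (F : Frame) : Set where
  open Frame F
  field
    finite   : IsFinite F
    _⊏?_     : Decidable _⊏_
    _≼?_     : Decidable _≼_
    ⊏-trans  : ∀ {x y z} → x ⊏ y → y ⊏ z → x ⊏ z
    ⊏-cwf    : WellFounded (flip _⊏_)
    ≼-refl   : ∀ {x} → x ≼ x
    ≼-trans  : ∀ {x y z} → x ≼ y → y ≼ z → x ≼ z
    directed : ∀ {x y z} → x ≼ y → x ≼ z → ∃ λ u → y ≼ u × z ≼ u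
    ≼-⊏      : ∀ {x y z} → x ≼ y → y ⊏ z → x ⊏ z
    ⊏-inv    : ∀ {x y z} → x ≼ y → x ⊏ z → y ⊏ z
    ⊏-≼      : ∀ {x y z} → x ⊏ y → y ≼ z → x ⊏ z

finite-all? : ∀ {A : Set} {P : A → Set} → (Σ ℕ λ n → Fin n ↔ A) →
              (∀ x → Dec (P x)) → Dec (∀ x → P x)
finite-all? {P = P} (n , e) P? =
  map′ (λ h x → subst P (strictlyInverseˡ x) (h (from x))) (λ h i → h (to i))
       (Fin.all? λ i → P? (to i))
  where open Inverse e

module Soundness {F : Frame} (conditions : PFConditions F) where
  open Frame F
  open PFConditions conditions

  forces? : ∀ V x A → Dec (_,_⊩_ F V x A)
  forces? V x (var n) = V n x Bool.≟ true
  forces? V x ⊥'      = no λ ()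
  forces? V x (A ⇒ B) = forces? V x A →-dec forces? V x B
  forces? V x (□p A)  = finite-all? finite λ y → (x ⊏? y) →-dec forces? V y A
  forces? V x (□f A)  = finite-all? finite λ y → (x ≼? y) →-dec forces? V y A

  theory : Valuation F → W → Fm → Bool
  theory V x A = does (forces? V x A)

  theory⁻ : ∀ V x A → theory V x A ≡ true → _,_⊩_ F V x A
  theory⁻ V x A eq with yes h ← forces? V x A = h

  -- Decided forcing commutes with implication, so it is an assignment to which tautologies apply.
  beval-theory : ∀ V x A → beval (theory V x) A ≡ theory V x A
  beval-theory V x (var n) = refl
  beval-theory V x ⊥'      = refl
  beval-theory V x (A ⇒ B) =
    cong₂ (λ a b → not a ∨ b) (beval-theory V x A) (beval-theory V x B)
  beval-theory V x (□p A)  = refl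
  beval-theory V x (□f A)  = refl

  sound : IsPFFrame F
  sound A (taut t) V x = theory⁻ V x A (trans (sym (beval-theory V x A)) (t _))
  sound _ (Kp A B) V x h a y r = h y r (a y r)
  -- Converse well-founded induction; transitivity keeps all later points within reach of `h`.
  sound _ (Löb A) V x h y r = go y (⊏-cwf y) r
    where
    go : ∀ y → Acc (flip _⊏_) y → x ⊏ y → _,_⊩_ F V y A
    go y (acc rec) r = h y r λ z s → go z (rec s) (⊏-trans r s)
  sound _ (Kf A B) V x h a y r = h y r (a y r)
  sound _ (Tf A) V x h = h x ≼-refl
  sound _ (4f A) V x h y r z s = h z (≼-trans r s)
  sound _ (G2f A) V x h y r n = h λ z s k →
    let u , yu , zu = directed r s in n u yu (k u zu)
  sound _ (pf1 A) V x h y r z s = h z (≼-⊏ r s)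
  sound _ (pf2 A) V x h y r n = h λ z s → n z (⊏-inv r s)
  sound _ (pf3 A) V x h y r z s = h z (⊏-≼ r s)
  sound _ (mp {A} p q) V x = sound _ p V x (sound A q V x)
  sound _ (necp p) V x y _ = sound _ p V y
  sound _ (necf p) V x y _ = sound _ p V y

-- Pre-Boolean frames from finite powersets

Subset-finite : ∀ n → Σ ℕ λ m → Fin m ↔ Subset n
Subset-finite ℕ.zero    =
  1 , mk↔ₛ′ (λ _ → []) (λ _ → zero) (λ { [] → refl }) λ { zero → refl ; (suc ()) }
Subset-finite (ℕ.suc n) = let m , e = Subset-finite n in
  2 ℕ.* m , ↔-trans Fin.*↔× (↔-trans (Fin.2↔Bool ×-↔ e)
    (mk↔ₛ′ (uncurry _∷_) uncons (λ { (_ ∷ _) → refl }) λ _ → refl))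

-- Every node carries a copy of the powerset of Fin N, each subset blown up to a
-- ≈-class of N points.
module PBAFrame (k N : ℕ) (_<ₙ_ : Rel (Fin (suc k)) 0ℓ)
                (isSPO : IsStrictPartialOrder _≡_ _<ₙ_) (_<ₙ?_ : Decidable _<ₙ_)
                (zero-least : ∀ i → zero <ₙ suc i) (c₀ : Fin N) where

  private module SPO = IsStrictPartialOrder isSPO

  World : Set
  World = Fin (suc k) × Subset N × Fin N

  frame : Frame
  frame = record
    { W     = World
    ; inhab = zero , S.⊥ , c₀
    ; _⊏_   = λ (i , _) (j , _) → i <ₙ j
    ; _≼_   = λ (i , X , _) (j , Y , _) → i ≡ j × X ⊆ Y
    }

  world-finite : IsFinite frame
  world-finite = let m , e = Subset-finite N in
    _ , ↔-trans Fin.*↔× (↔-refl ×-↔ ↔-trans (Fin.*↔× {m}) (e ×-↔ ↔-refl))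

  conditions : PFConditions frame
  conditions = record
    { finite   = world-finite
    ; _⊏?_     = λ (i , _) (j , _) → i <ₙ? j
    ; _≼?_     = λ (i , X , _) (j , Y , _) → (i Fin.≟ j) ×-dec (X S.⊆? Y)
    ; ⊏-trans  = SPO.trans
    ; ⊏-cwf    = λ (i , _) → cwf (spo-noetherian isSPO i)
    ; ≼-refl   = refl , λ h → h
    ; ≼-trans  = λ (p , h) (q , g) → trans p q , λ m → g (h m)
    ; directed = λ { {_} {i , X , c} {_ , Y , _} (refl , _) (refl , _) →
                     (i , X ∪ Y , c) , (refl , S.p⊆p∪q Y) , (refl , S.q⊆p∪q X Y) }
    ; ≼-⊏      = λ { (refl , _) s → s }
    ; ⊏-inv    = λ { (refl , _) s → s }
    ; ⊏-≼      = λ { s (refl , _) → s }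
    }
    where
    cwf : ∀ {i X} → Acc (flip _<ₙ_) i → Acc (flip (Frame._⊏_ frame)) (i , X)
    cwf (acc rec) = acc λ s → cwf (rec s)

  same-node : ∀ {x y} → _∼⁺_ frame x y → proj₁ x ≡ proj₁ y
  same-node [ inj₁ (p , _) ] = p
  same-node [ inj₂ (p , _) ] = sym p
  same-node (inj₁ (p , _) ∷ rs) = trans p (same-node rs)
  same-node (inj₂ (p , _) ∷ rs) = trans (sym p) (same-node rs)

  connected : ∀ {x y} → proj₁ x ≡ proj₁ y → _∼⁺_ frame x y
  connected {i , _} p =
    -- Both points lie above the empty subset of their common node, so two steps join them.
    _∷_ {y = i , S.⊥ , c₀} (inj₂ (refl , S.⊥⊆)) [ inj₁ (p , S.⊥⊆) ]

  nice : IsNice frame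
  nice _ _ _ s (refl , _) = s

  ⊥-root : ∀ i c → Is≼Root frame (i , S.⊥ , c)
  ⊥-root i c y r = same-node r , S.⊥⊆

  zero-⊏-root : ∀ X c → IsSqRoot frame (zero , X , c)
  zero-⊏-root X c (zero , _)  = inj₁ (connected refl)
  zero-⊏-root X c (suc i , _) = inj₂ (zero-least i)

  rooted : IsRooted frame
  rooted = (_ , zero-⊏-root S.⊥ c₀) ,
           λ (i , _) → (i , S.⊥ , c₀) , connected refl , ⊥-root i c₀

  -- The operations act on subsets and always return the copy `c₀`, because `≈` ignores the copy.
  pba : IsPBA frame
  pba x@(i , _) = (λ a b → point (set a ∪ set b)) , (λ a b → point (set a ∩ set b)) ,
    (λ a → point (∁ (set a))) , point S.⊤ , point S.⊥ , record
    { isHeytingAlgebra = record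
      { isBoundedLattice = record
        { isLattice = record
          { isPartialOrder = record
            { isPreorder = record
              { isEquivalence = record
                { refl  = λ {a} → ≤-refl {a} , ≤-refl {a}
                ; sym   = λ (p , q) → q , p
                ; trans = λ {a b c} (p , p') (q , q') →
                    ≤-trans {a} {b} {c} p q , ≤-trans {c} {b} {a} q' p'
                }
              ; reflexive = proj₁
              ; trans     = λ {a b c} → ≤-trans {a} {b} {c}
              }
            ; antisym = _,_
            }
          ; supremum = λ a b →
              le {a} {point _} (S.p⊆p∪q (set b)) ,
              le {b} {point _} (S.q⊆p∪q (set a) (set b)) ,
              λ c (_ , p) (_ , q) → le {point _} {c} λ m →
                Sum.[ p , q ] (S.x∈p∪q⁻ (set a) (set b) m)
          ; infimum = λ a b →
              le {point _} {a} (S.p∩q⊆p (set a) (set b)) ,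
              le {point _} {b} (S.p∩q⊆q (set a) (set b)) ,
              λ c (_ , p) (_ , q) → le {c} {point _} λ m → S.x∈p∩q⁺ (p m , q m)
          }
        ; maximum = λ a → le {a} {point _} S.⊆⊤
        ; minimum = λ a → le {point _} {a} S.⊥⊆
        }
      -- Implication is the complement of `b` joined with `c`; deciding membership in `b` proves one
      -- half.
      ; exponential = λ a b c →
          (λ (_ , p) → le {a} {point _} λ {z} m → S.x∈p∪q⁺ (residual p m (z S.∈? set b))) ,
          (λ (_ , p) → le {point _} {c} λ m →
            let u , v = S.x∈p∩q⁻ (set a) (set b) m in
            Sum.[ (λ w → ⊥-elim (S.x∈∁p⇒x∉p w v)) , (λ w → w) ]
              (S.x∈p∪q⁻ (∁ (set b)) (set c) (p u)))
      }
    }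
    where
    C = Cluster frame x
    set : C → Subset N
    set ((_ , X , _) , _) = X
    point : Subset N → C
    point X = (i , X , c₀) , connected refl
    _≤_ : C → C → Set
    _≤_ = _≼c_ frame x
    le : ∀ {a b} → set a ⊆ set b → a ≤ b
    le {_ , p} {_ , q} h = trans (sym (same-node p)) (same-node q) , h
    ≤-refl : ∀ {a} → a ≤ a
    ≤-refl = refl , λ m → m
    ≤-trans : ∀ {a b c} → a ≤ b → b ≤ c → a ≤ c
    ≤-trans (p , h) (q , g) = trans p q , λ m → g (h m)
    residual : ∀ {X Y Z : Subset N} {z} → X ∩ Y ⊆ Z → z ∈ₛ X → Dec (z ∈ₛ Y) →
               z ∈ₛ ∁ Y ⊎ z ∈ₛ Z
    residual p m (yes n) = inj₂ (p (S.x∈p∩q⁺ (m , n)))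
    residual p m (no n)  = inj₁ (S.x∉p⇒x∈∁p n)

  finRootedNicePBA : FinRootedNicePBA frame
  finRootedNicePBA = world-finite , Soundness.sound conditions , nice , rooted , pba

-- A finite preorder with bottom r and top t is the image of a pre-Boolean algebra:
-- a subset X that is a chain is sent to its maximum (to r if X is empty), any other
-- subset to t.  Enlarging X moves the value up, and adjoining to a chain X a point
-- above its maximum reaches that point.
module ChainCover {N} (_≤_ : Rel (Fin N) 0ℓ) (≤-refl : ∀ {c} → c ≤ c)
                  (≤-trans : ∀ {a b c} → a ≤ b → b ≤ c → a ≤ c) (_≤?_ : Decidable _≤_)
                  (r t : Fin N) (r≤t : r ≤ t) (greatest : ∀ {c} → r ≤ c → c ≤ t) where

  Chain : Subset N → Set
  Chain X = (∀ x → x ∈ₛ X → r ≤ x)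
          × (∀ x → x ∈ₛ X → ∀ y → y ∈ₛ X → x ≤ y ⊎ y ≤ x)

  -- `r` counts as a member of every chain, which covers the empty one. Such `c` are unique only up
  -- to equivalence.
  IsMax : Subset N → Fin N → Set
  IsMax X c = (∀ x → x ∈ₛ X → x ≤ c) × r ≤ c × (c ≤ r ⊎ ∃ λ x → x ∈ₛ X × c ≤ x)

  Eligible : Subset N → Fin N → Set
  Eligible X c = (Chain X × IsMax X c) ⊎ (¬ Chain X × r ≤ c × t ≤ c)

  chain? : ∀ X → Dec (Chain X)
  chain? X = Fin.all? (λ x → (x S.∈? X) →-dec (r ≤? x)) ×-dec
    Fin.all? λ x → (x S.∈? X) →-dec
    Fin.all? λ y → (y S.∈? X) →-dec ((x ≤? y) ⊎-dec (y ≤? x))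

  eligible? : ∀ X c → Dec (Eligible X c)
  eligible? X c =
    (chain? X ×-dec (Fin.all? (λ x → (x S.∈? X) →-dec (x ≤? c)) ×-dec (r ≤? c) ×-dec
      ((c ≤? r) ⊎-dec Fin.any? λ x → (x S.∈? X) ×-dec (c ≤? x))))
    ⊎-dec (¬? (chain? X) ×-dec (r ≤? c) ×-dec (t ≤? c))

  list-max : ∀ {X} → Chain X → ∀ xs → All (_∈ₛ X) xs →
             ∃ λ m → All (_≤ m) xs × r ≤ m × (m ≤ r ⊎ (m ∈ₛ X))
  list-max ch []       []       = r , [] , ≤-refl , inj₁ ≤-refl
  list-max {X} ch@(lo , cmp) (x ∷ xs) (i ∷ is) with list-max ch xs is
  ... | m , below , rm , inj₁ mr =
    x , (≤-refl ∷ All.map (λ h → ≤-trans h (≤-trans mr (lo x i))) below) , lo x i , inj₂ i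
  ... | m , below , rm , inj₂ j with cmp x i m j
  ...   | inj₁ xm = m , (xm ∷ below) , rm , inj₂ j
  ...   | inj₂ mx = x , (≤-refl ∷ All.map (λ h → ≤-trans h mx) below) , lo x i , inj₂ i

  eligible-exists : ∀ X → ∃ (Eligible X)
  eligible-exists X with chain? X
  ... | no n   = t , inj₂ (n , r≤t , ≤-refl)
  ... | yes ch =
    let m , below , rm , top = list-max ch (filter (S._∈? X) (allFin N))
                                 (All.all-filter (S._∈? X) (allFin N))
    in m , inj₁ (ch , (λ x i → All.lookup below (∈-filter⁺ (S._∈? X) (∈-allFin x) i)) , rm ,
                 Sum.map₂ (λ j → m , j , ≤-refl) top)

  ⊥-eligible : Eligible S.⊥ r
  ⊥-eligible = inj₁ (((λ x i → ⊥-elim (S.∉⊥ i)) , λ x i → ⊥-elim (S.∉⊥ i)) ,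
                     (λ x i → ⊥-elim (S.∉⊥ i)) , ≤-refl , inj₁ ≤-refl)

  eligible-r≤ : ∀ {X c} → Eligible X c → r ≤ c
  eligible-r≤ (inj₁ (_ , _ , h , _)) = h
  eligible-r≤ (inj₂ (_ , h , _))     = h

  -- Subsets of chains are chains, so a value equivalent to `t` never drops on enlarging. The value
  -- of a chain is below `r` or one of its points, hence below the value of a larger chain.
  eligible-mono : ∀ {X Y c d} → X ⊆ Y → Eligible X c → Eligible Y d → c ≤ d
  eligible-mono X⊆Y e (inj₂ (_ , _ , td)) = ≤-trans (greatest (eligible-r≤ e)) td
  eligible-mono X⊆Y (inj₁ (_ , _ , _ , inj₁ cr)) (inj₁ (_ , _ , rd , _)) = ≤-trans cr rd
  eligible-mono X⊆Y (inj₁ (_ , _ , _ , inj₂ (x , i , cx))) (inj₁ (_ , ub , _)) =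
    ≤-trans cx (ub x (X⊆Y i))
  eligible-mono X⊆Y (inj₂ (n , _)) (inj₁ ((lo , cmp) , _)) =
    ⊥-elim (n ((λ x i → lo x (X⊆Y i)) , λ x i y j → cmp x (X⊆Y i) y (X⊆Y j)))

  eligible-back : ∀ {X c d} → Eligible X c → c ≤ d → ∃ λ Y → X ⊆ Y × Eligible Y d
  -- Here `c` is above `t`, hence so is `d`, and `X` itself serves.
  eligible-back {X} (inj₂ (n , rc , tc)) cd =
    X , (λ m → m) , inj₂ (n , ≤-trans rc cd , ≤-trans tc cd)
  eligible-back {X} {c} {d} (inj₁ ((lo , cmp) , ub , rc , _)) cd =
    X ∪ ⁅ d ⁆ , S.p⊆p∪q ⁅ d ⁆ ,
    inj₁ ((lo' , cmp') , ub' , rd , inj₂ (d , S.q⊆p∪q X ⁅ d ⁆ (S.x∈⁅x⁆ d) , ≤-refl))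
    where
    rd : r ≤ d
    rd = ≤-trans rc cd
    split : ∀ {x} → x ∈ₛ X ∪ ⁅ d ⁆ → x ∈ₛ X ⊎ x ≡ d
    split i = Sum.map₂ (S.x∈⁅y⁆⇒x≡y d) (S.x∈p∪q⁻ X ⁅ d ⁆ i)
    ub' : ∀ x → x ∈ₛ X ∪ ⁅ d ⁆ → x ≤ d
    ub' x i with split i
    ... | inj₁ j    = ≤-trans (ub x j) cd
    ... | inj₂ refl = ≤-refl
    lo' : ∀ x → x ∈ₛ X ∪ ⁅ d ⁆ → r ≤ x
    lo' x i with split i
    ... | inj₁ j    = lo x j
    ... | inj₂ refl = rd
    cmp' : ∀ x → x ∈ₛ X ∪ ⁅ d ⁆ → ∀ y → y ∈ₛ X ∪ ⁅ d ⁆ → x ≤ y ⊎ y ≤ x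
    cmp' x i y j with split i | split j
    ... | inj₁ i'   | inj₁ j'   = cmp x i' y j'
    ... | inj₂ refl | _         = inj₂ (ub' y j)
    ... | inj₁ _    | inj₂ refl = inj₁ (ub' x i)

  -- The copy `c` selects among equivalent eligible values, which may still differ on formulas, so
  -- each is realised; an ineligible `c` falls back to some eligible value.
  label : Subset N → Fin N → Fin N
  label X c with eligible? X c
  ... | yes _ = c
  ... | no _  = proj₁ (eligible-exists X)

  label-eligible : ∀ X c → Eligible X (label X c)
  label-eligible X c with eligible? X c
  ... | yes h = h
  ... | no _  = proj₂ (eligible-exists X)

  label-fixes : ∀ {X c} → Eligible X c → label X c ≡ c
  label-fixes {X} {c} h with eligible? X c
  ... | yes _ = refl
  ... | no n  = ⊥-elim (n h)

-- Completeness

record Quasimodel (Φ : List Fm) : Set₁ where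
  infix 4 _≼_ _⊏_
  field
    size         : ℕ
    val          : Fin size → Fm → Bool
    _≼_ _⊏_      : Rel (Fin size) 0ℓ
    _≼?_         : Decidable _≼_
    _⊏?_         : Decidable _⊏_
    ≼-refl       : ∀ {i} → i ≼ i
    ≼-trans      : ∀ {i j k} → i ≼ j → j ≼ k → i ≼ k
    ⊏-irrefl     : ∀ {i} → ¬ i ⊏ i
    ⊏-trans      : ∀ {i j k} → i ⊏ j → j ⊏ k → i ⊏ k
    top          : Fin size → Fin size
    ≼-top        : ∀ {i} → i ≼ top i
    top-greatest : ∀ {i j} → i ≼ j → j ≼ top i
    □f-refl      : ∀ {i X} → X ∈ Φ → val i ⊨ □f X → val i ⊨ X
    □f-up        : ∀ {i j} → i ≼ j → ∀ {X} → X ∈ Φ → val i ⊨ □f X → val j ⊨ □f X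
    □p-up        : ∀ {i j} → i ≼ j → ∀ {X} → X ∈ Φ → val i ⊨ □p X → val j ⊨ □p X
    □p-down      : ∀ {i j} → i ≼ j → ∀ {X} → X ∈ Φ → val j ⊨ □p X → val i ⊨ □p X
    ⊏-□f         : ∀ {i j} → i ⊏ j → ∀ {X} → X ∈ Φ → val i ⊨ □p X → val j ⊨ □f X
    f-witness    : ∀ i {X} → X ∈ Φ → val i ⊨ □f X ⊎ ∃ λ j → i ≼ j × ¬ val j ⊨ X
    p-witness    : ∀ i {X} → X ∈ Φ → val i ⊨ □p X ⊎ ∃ λ j → i ⊏ j × ¬ val j ⊨ X

-- The model over a quasimodel and its truth lemma

module Model {Φ} (closed : SubformulaClosed Φ) (Q : Quasimodel Φ)
             (e₀ : Fin (Quasimodel.size Q)) where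
  open Quasimodel Q

  above : List (Fin size)
  above = filter (λ j → e₀ ⊏? j) (allFin size)

  node : Fin (suc (length above)) → Fin size
  node zero    = e₀
  node (suc i) = lookup above i

  infix 4 _<ₙ_

  _<ₙ_ : Rel (Fin (suc (length above))) 0ℓ
  i <ₙ j = node i ⊏ node j

  zero-least : ∀ i → zero <ₙ suc i
  zero-least i = proj₂ (∈-filter⁻ (λ j → e₀ ⊏? j) {xs = allFin _}
                                  (∈-lookup {xs = above} i))

  node-surjective : ∀ i j → node i ⊏ j → ∃ λ i' → node i' ≡ j
  node-surjective i j r = suc (Any.index j∈) , sym (Any.lookup-index j∈)
    where
    e₀⊏ : ∀ i → node i ⊏ j → e₀ ⊏ j
    e₀⊏ zero    s = s
    e₀⊏ (suc i) s = ⊏-trans (zero-least i) s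
    j∈ : j ∈ above
    j∈ = ∈-filter⁺ _ (∈-allFin j) (e₀⊏ i r)

  <ₙ-isStrictPartialOrder : IsStrictPartialOrder _≡_ _<ₙ_
  <ₙ-isStrictPartialOrder = record
    { isEquivalence = isEquivalence
    ; irrefl        = λ { refl → ⊏-irrefl }
    ; trans         = ⊏-trans
    ; <-resp-≈      = resp₂ _<ₙ_
    }

  open PBAFrame (length above) size _<ₙ_ <ₙ-isStrictPartialOrder
    (λ i j → node i ⊏? node j) zero-least e₀ public

  module Cover i = ChainCover _≼_ ≼-refl ≼-trans _≼?_
    (node i) (top (node i)) ≼-top top-greatest

  ℓ : World → Fin size
  ℓ (i , X , c) = Cover.label i X c

  -- Since `□p X` is constant along `≼`, this allows questions about `□p` to be settled at the node.
  node≼ℓ : ∀ w → node (proj₁ w) ≼ ℓ w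
  node≼ℓ (i , X , c) = Cover.eligible-r≤ i (Cover.label-eligible i X c)

  ℓ-at-⊥ : ∀ i → ℓ (i , S.⊥ , node i) ≡ node i
  ℓ-at-⊥ i = Cover.label-fixes i (Cover.⊥-eligible i)

  ℓ-mono : ∀ {w v} → Frame._≼_ frame w v → ℓ w ≼ ℓ v
  ℓ-mono {i , X , c} {_ , Y , d} (refl , X⊆Y) =
    Cover.eligible-mono i X⊆Y (Cover.label-eligible i X c) (Cover.label-eligible i Y d)

  -- `□p X` descends from `ℓ w` to its node, becomes `□f X` at the node of `v`, and rises to `ℓ v`.
  p-forth : ∀ {w v X} → X ∈ Φ → val (ℓ w) ⊨ □p X → Frame._⊏_ frame w v → val (ℓ v) ⊨ X
  p-forth {w} {v} m h r = □f-refl m (□f-up (node≼ℓ v) m (⊏-□f r m (□p-down (node≼ℓ w) m h)))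

  f-forth : ∀ {w v X} → X ∈ Φ → val (ℓ w) ⊨ □f X → Frame._≼_ frame w v → val (ℓ v) ⊨ X
  f-forth {v = v} m h r = □f-refl m (□f-up (ℓ-mono r) m h)

  p-back : ∀ w {X} → X ∈ Φ → (∀ v → Frame._⊏_ frame w v → val (ℓ v) ⊨ X) → val (ℓ w) ⊨ □p X
  p-back w@(i , _) {X} m h with p-witness (node i) m
  ... | inj₁ k = □p-up (node≼ℓ w) m k
  ... | inj₂ (j , r , n) with node-surjective i j r
  -- The witness is itself a node, and is the label of the empty subset there with copy `j`.
  ...   | i' , refl = ⊥-elim (n (subst (λ c → val c ⊨ X) (ℓ-at-⊥ i')
                                  (h (i' , S.⊥ , j) r)))

  f-back : ∀ w {X} → X ∈ Φ → (∀ v → Frame._≼_ frame w v → val (ℓ v) ⊨ X) → val (ℓ w) ⊨ □f X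
  f-back w@(i , Z , c) {X} m h with f-witness (ℓ w) m
  ... | inj₁ k = k
  -- Enlarging `Z` makes the witness `j` eligible, and the copy `j` selects exactly it.
  ... | inj₂ (j , r , n) with Cover.eligible-back i (Cover.label-eligible i Z c) r
  ...   | Y , Z⊆Y , e = ⊥-elim (n (subst (λ c → val c ⊨ X) (Cover.label-fixes i e)
                                    (h (i , Y , j) (refl , Z⊆Y))))

  V : Valuation frame
  V n w = beval (val (ℓ w)) (var n)

  open SubformulaClosed closed

  -- The two directions are mutual because implication swaps them.
  truth⁺ : ∀ X → X ∈ Φ → ∀ w → val (ℓ w) ⊨ X → _,_⊩_ frame V w X
  truth⁻ : ∀ X → X ∈ Φ → ∀ w → _,_⊩_ frame V w X → val (ℓ w) ⊨ X

  truth⁺ (var n) m w (holds h) = h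
  truth⁺ ⊥'      m w h         = ⊭⊥ h
  truth⁺ (A ⇒ B) m w h a       = truth⁺ B (⇒ʳ m) w (⊨-⇒⁻ h (truth⁻ A (⇒ˡ m) w a))
  truth⁺ (□p A)  m w h v r     = truth⁺ A (p m) v (p-forth {w} {v} (p m) h r)
  truth⁺ (□f A)  m w h v r     = truth⁺ A (f m) v (f-forth {w} {v} (f m) h r)

  truth⁻ (var n) m w h = holds h
  truth⁻ (A ⇒ B) m w h = ⊨-⇒⁺ λ a → truth⁻ B (⇒ʳ m) w (h (truth⁺ A (⇒ˡ m) w a))
  truth⁻ (□p A)  m w h = p-back w (p m) λ v r → truth⁻ A (p m) v (h v r)
  truth⁻ (□f A)  m w h = f-back w (f m) λ v r → truth⁻ A (f m) v (h v r)

-- The quasimodel of a saturated list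

module SaturatedModel (Φ : List Fm) (closed : SubformulaClosed Φ) where
  open Elimination Φ closed

  module _ {L : List Desc} (saturated : All (Saturated L) L) where

    at : Fin (length L) → Desc
    at = lookup L

    sat : ∀ i → Saturated L (at i)
    sat i = All.lookup saturated (∈-lookup i)

    witness : ∀ {R X} → Witness L R X → ∃ λ j → R (at j) × ¬ ⟦ at j ⟧ ⊨ X
    witness w = Any.index w , Any.lookup-index w

    -- In a final description every eventually persistent □f X already holds.
    Final : Desc → List Fm → Set
    Final e = All (λ X → ⟦ e ⟧ ⊨ ◇f (□f X) → ⟦ e ⟧ ⊨ □f X)

    in-persistent : ∀ {P : Fm → Set} → (∀ {χ} → χ ∈ persistent → P χ) →
      (∀ {X} → X ∈ Φ → P (□p X) × P (¬' (□p X)) × P (□f X) × P (□f¬□f X) × P (◇f (□f X)))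
    in-persistent h m =
      h (∈-++⁺ˡ (∈-map⁺ _ m)) ,
      h (∈-++⁺ʳ (map □p Φ) (∈-++⁺ˡ (∈-map⁺ _ m))) ,
      h (∈-++⁺ʳ (map □p Φ) (∈-++⁺ʳ (map _ Φ) (∈-++⁺ˡ (∈-map⁺ _ m)))) ,
      h (∈-++⁺ʳ (map □p Φ) (∈-++⁺ʳ (map _ Φ) (∈-++⁺ʳ (map □f Φ) (∈-++⁺ˡ (∈-map⁺ _ m))))) ,
      h (∈-++⁺ʳ (map □p Φ) (∈-++⁺ʳ (map _ Φ) (∈-++⁺ʳ (map □f Φ)
           (∈-++⁺ʳ (map □f¬□f Φ) (∈-map⁺ _ m)))))

    module _ {d e} (d≼e : d ≼ e) {X} (m : X ∈ Φ) where
      private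
        go = in-persistent {P = λ χ → ⟦ d ⟧ ⊨ χ → ⟦ e ⟧ ⊨ χ} (All.lookup d≼e) m

      □p-up : ⟦ d ⟧ ⊨ □p X → ⟦ e ⟧ ⊨ □p X
      □p-up = proj₁ go

      -- Persistence of `¬' (□p X)` read contrapositively; `◇□f-down` arises likewise from
      -- `□f¬□f X`.
      □p-down : ⟦ e ⟧ ⊨ □p X → ⟦ d ⟧ ⊨ □p X
      □p-down h = ⊨-stable λ n → ⊨-¬⁻ (proj₁ (proj₂ go) (⊨-¬⁺ n)) h

      □f-up : ⟦ d ⟧ ⊨ □f X → ⟦ e ⟧ ⊨ □f X
      □f-up = proj₁ (proj₂ (proj₂ go))

      ◇□f-up : ⟦ d ⟧ ⊨ ◇f (□f X) → ⟦ e ⟧ ⊨ ◇f (□f X)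
      ◇□f-up = proj₂ (proj₂ (proj₂ (proj₂ go)))

      ◇□f-down : ⟦ e ⟧ ⊨ ◇f (□f X) → ⟦ d ⟧ ⊨ ◇f (□f X)
      ◇□f-down h = ⊨-¬⁺ λ k → ⊨-¬⁻ h (proj₁ (proj₂ (proj₂ (proj₂ go))) k)

    ¬□f∈f-boxed : ∀ {X} → X ∈ Φ → ¬' (□f X) ∈ f-boxed
    ¬□f∈f-boxed m = ∈-++⁺ʳ Φ (∈-map⁺ _ m)

    □f⇒◇□f : ∀ i {X} → X ∈ Φ → ⟦ at i ⟧ ⊨ □f X → ⟦ at i ⟧ ⊨ ◇f (□f X)
    □f⇒◇□f i m h = ⊨-¬⁺ λ k →
      ⊨-¬⁻ (All.lookup (Saturated.reflexive (sat i)) (¬□f∈f-boxed m) k) h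

    -- Formulas are treated one at a time, by moving to a witness with `□f X` if there is one.
    -- Earlier ones stay settled: `◇f (□f X)` goes back down and `□f X` persists.
    final-above : ∀ i → ∃ λ j → at i ≼ at j × Final (at j) Φ
    final-above i = go Φ λ m → m
      where
      go : ∀ Xs → (∀ {X} → X ∈ Xs → X ∈ Φ) → ∃ λ j → at i ≼ at j × Final (at j) Xs
      go []       _   = i , ≼-refl , []
      go (X ∷ Xs) sub with go Xs (λ m → sub (there m))
      ... | j , r , fin with All.lookup (Saturated.f-witness (sat j)) (¬□f∈f-boxed (sub (here refl)))
      ...   | inj₁ h = j , r , (λ k → ⊥-elim (⊨-¬⁻ k h)) ∷ fin
      ...   | inj₂ w with witness w
      ...     | k , s , n = k , ≼-trans r s , (λ _ → ⊨-¬¬⁻ n) ∷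
                All.tabulate λ m h → □f-up s (sub (there m))
                  (All.lookup fin m (◇□f-down s (sub (there m)) h))

    -- Apart from `□f X`, all persistent formulas are constant on the cone of `i`. If `□f X` holds
    -- at `k`, then `◇f (□f X)` holds at `k`, `i` and `j`, and finality gives `□f X` at `j`.
    final-greatest : ∀ {i j k} → at i ≼ at j → Final (at j) Φ → at i ≼ at k → at k ≼ at j
    final-greatest {i} {j} {k} ij fin ik = all-persistent
      (λ m h → □p-up ij m (□p-down ik m h))
      (λ m h → ⊨-¬⁺ λ x → ⊨-¬⁻ h (□p-up ik m (□p-down ij m x)))
      (λ m h → All.lookup fin m (◇□f-up ij m (◇□f-down ik m (□f⇒◇□f k m h))))
      (λ m h → ⊨-stable λ n → ⊨-¬⁻ (◇□f-up ik m (◇□f-down ij m (⊨-¬⁺ n))) h)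
      (λ m h → ◇□f-up ij m (◇□f-down ik m h))

    quasimodel : Quasimodel Φ
    quasimodel = record
      { size         = length L
      ; val          = λ i → ⟦ at i ⟧
      ; _≼_          = λ i j → at i ≼ at j
      ; _⊏_          = λ i j → at i ⊏ at j
      ; _≼?_         = λ i j → at i ≼? at j
      ; _⊏?_         = λ i j → at i ⊏? at j
      ; ≼-refl       = ≼-refl
      ; ≼-trans      = ≼-trans
      ; ⊏-irrefl     = ⊏-irrefl
      ; ⊏-trans      = ⊏-trans
      ; top          = λ i → proj₁ (final-above i)
      ; ≼-top        = λ {i} → proj₁ (proj₂ (final-above i))
      ; top-greatest = λ {i} → let _ , r , fin = final-above i in final-greatest r fin
      ; □f-refl      = λ {i} m → All.lookup (Saturated.reflexive (sat i)) (∈-++⁺ˡ m)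
      ; □f-up        = □f-up
      ; □p-up        = □p-up
      ; □p-down      = □p-down
      ; ⊏-□f         = λ r m h → proj₂ (All.lookup (proj₁ r) m h)
      ; f-witness    = λ i m →
          Sum.map₂ witness (All.lookup (Saturated.f-witness (sat i)) (∈-++⁺ˡ m))
      ; p-witness    = λ i m → Sum.map₂ witness (All.lookup (Saturated.p-witness (sat i)) m)
      }

-- It suffices that `A` is true at every survivor `d`. The model with `e₀` the index of `d` has a
-- root point labelled `d`, where the hypothesis forces `A`, and the truth lemma applies.
complete : ∀ A → Cond4 A → PF⊢ A
complete A cond4 with Elimination.saturate (subs A) (subs-closed A)
... | L , L-complete , L-saturated = L-complete λ m → det⁻ (det A A∈) (true-in m)
  where
  open Elimination (subs A) (subs-closed A)
  open SaturatedModel (subs A) (subs-closed A) using (quasimodel)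
  A∈ : A ∈ subs A
  A∈ = self∈subs A
  true-in : ∀ {d} → d ∈ L → ⟦ d ⟧ ⊨ A
  true-in {d} m = subst (λ c → ⟦ c ⟧ ⊨ A) (sym (Any.lookup-index m))
    (subst (λ c → ⟦ lookup L c ⟧ ⊨ A) (ℓ-at-⊥ zero)
      (truth⁻ A A∈ z
        (cond4 frame finRootedNicePBA V z z (zero-⊏-root S.⊥ e₀) (connected refl)
          (⊥-root zero e₀))))
    where
    e₀ = Any.index m
    open Model (subs-closed A) (quasimodel L-saturated) e₀
    z : World
    z = zero , S.⊥ , e₀

theorem4p7 : (A : Fm) →
    (Cond1 A ⇔ Cond2 A) × (Cond1 A ⇔ Cond3 A) × (Cond1 A ⇔ Cond4 A)
theorem4p7 A =
  mk⇔ 1⇒2 (λ h → complete A (3⇒4 (2⇒3 h))) ,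
  mk⇔ (λ h → 2⇒3 (1⇒2 h)) (λ h → complete A (3⇒4 h)) ,
  mk⇔ (λ h → 3⇒4 (2⇒3 (1⇒2 h))) (complete A)
  where
  -- PF-frames validate all theorems by definition; soundness enters through `finRootedNicePBA`.
  1⇒2 : Cond1 A → Cond2 A
  1⇒2 h F pf = pf A h
  2⇒3 : Cond2 A → Cond3 A
  2⇒3 h F (_ , pf , _) = h F pf
  3⇒4 : Cond3 A → Cond4 A
  3⇒4 h F good V r z _ _ _ = h F good V z
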